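{- Let $\mathcal{R}$ be any complete representation. Every $(A\cup B)$-regular $\textsf{MRes- }\mathcal{R}$ refutation of $\textsf{CR}_n$ has size $2^{\Omega(n)}$.
   Context: The completion formulas: $\textsf{CR}_n = \exists \{x_{ij}\}_{i,j\in[n]}\ \forall z\ \exists \{a_i\}_{i\in[n]}\ \exists\{b_j\}_{j\in[n]}.\ \big(\bigwedge_{i,j\in[n]}(A_{ij}\wedge B_{ij})\big)\wedge L_A\wedge L_B$, where $A_{ij}=x_{ij}\vee z\vee a_i$, $B_{ij}=\overline{x_{ij}}\vee\bar z\vee b_j$, $L_A=\overline{a_1}\vee\dots\vee\overline{a_n}$, $L_B=\overline{b_1}\vee\dots\vee\overline{b_n}$; $A=\{a_1,\dots,a_n\}$, $B=\{b_1,\dots,b_n\}$. General setting: for a QBF $\Phi=Q.\phi$ in closed prenex CNF with existential variables $X$ and universal $U$, $y<_Q x$ means $y$ is in an earlier block, $L_Q(u)$ = existential variables left of $u$. Falsifying $u$-literal of $C\in\phi$: $0$ if $u\in C$, $1$ if $\bar u\in C$, $\ast$ otherwise; existential subclause = existential literals of $C$. A strategy for $u$ is a function from assignments of $L_Q(u)$ to $\{0,1,\ast\}$. $p\simeq q$ for $p,q\in\{0,1,\ast\}$ if $p=\ast$, $q=\ast$ or $p=q$; strategies consistent if pointwise consistent; $H\circ H'$ (for consistent $H,H'$) takes $H(\varepsilon)$ if $\ne\ast$ else $H'(\varepsilon)$; $H\overset{x}{\bowtie}H'$ is $H$ on $x=1$ and $H'$ on $x=0$. A representation is complete if every finite function has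 at least one representation in it. For a complete $\mathcal{R}$, an $\textsf{MRes- }\mathcal{R}$ derivation is a sequence of lines $(C_i,\{H^u_i:u\in U\})$, $C_i$ a clause of existential literals, $H^u_i$ strategies given in $\mathcal{R}$, each line either an axiom ($C_i$ the existential subclause of some $C\in\phi$, $H^u_i$ constant equal to the falsifying $u$-literal of $C$) or a resolution step ($a,b<i$, existential pivot $x$, $C_i=res(C_a,C_b,x)$ where $res(C\vee x,D\vee\bar x,x)=C\vee D$, and for each $u$: $H^u_i=H^u_b\overset{x}{\bowtie}H^u_a$ if $x<_Q u$; $H^u_a\simeq H^u_b$ and $H^u_i=H^u_a\circ H^u_b$ if $u<_Q x$). A refutation ends with the empty clause; its size is its number of lines. The derivation graph $G_\pi$ has the lines as nodes and edges from each hypothesis of a resolution step to its resolvent. For a set $S$ of existential variables, $\pi$ is $S$-regular if for each $x\in S$ no leaf-to-root path in $G_\pi$ uses $x$ as pivot more than once. -}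

module Defs where

open import Level using (Level)
open import Data.Bool using (Bool; true; false; _∧_; _∨_; not; if_then_else_)
open import Data.Nat using (ℕ; suc; _<_; _<ᵇ_)
open import Data.Fin as Fin using (Fin; fromℕ)
open import Data.List using (List; []; _∷_; _++_; length; lookup; filterᵇ; concatMap; map; allFin)
open import Data.Product using (Σ; _×_; _,_; proj₁; proj₂)
open import Data.Sum using (_⊎_)
open import Data.Maybe using (Maybe; just; nothing)
open import Data.Unit using (⊤)
open import Data.Empty using (⊥)
open import Relation.Nullary using (¬_; yes; no)
open import Relation.Nullary.Decidable using (⌊_⌋)
open import Relation.Binary.Definitions using (DecidableEquality)
open import Relation.Binary.PropositionalEquality using (_≡_; refl; cong; cong₂)
open import Relation.Binary.Construct.Closure.ReflexiveTransitive using (Star)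
import Data.Bool.Properties as BoolP

data Val : Set where
  v0 v1 ⋆ : Val

_≃v_ : Val → Val → Set
⋆  ≃v _  = ⊤
v0 ≃v ⋆  = ⊤
v1 ≃v ⋆  = ⊤
v0 ≃v v0 = ⊤
v1 ≃v v1 = ⊤
v0 ≃v v1 = ⊥
v1 ≃v v0 = ⊥

_∘v_ : Val → Val → Val
⋆  ∘v q = q
v0 ∘v _ = v0
v1 ∘v _ = v1

record Representation : Set₁ where
  field
    Code : ℕ → Set
    ⟦_⟧  : ∀ {k} → Code k → (Fin k → Bool) → Val

Complete : Representation → Set
Complete R = ∀ k (f : (Fin k → Bool) → Val) →
             Σ (Code k) λ c → ∀ α → ⟦ c ⟧ α ≡ f α
  where open Representation R

-- QBFs in closed prenex CNF.
-- Variables of type V; `vars` lists all variables; `lev v` is the index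
-- of the quantifier block of v (y <_Q x iff lev y < lev x); `univ v` says
-- whether v is universal. Literals are (variable , polarity) with
-- polarity true = positive. Clauses are sets of literals (membership
-- predicates).

Lit : Set → Set
Lit V = V × Bool

Clause : Set → Set
Clause V = Lit V → Bool

record QBF : Set₁ where
  field
    V      : Set
    _≟V_   : DecidableEquality V
    vars   : List V
    lev    : V → ℕ
    univ   : V → Bool
    matrix : List (Clause V)

module MRes (Φ : QBF) (R : Representation) where
  open QBF Φ
  open Representation R

  U : Set
  U = Σ V λ u → univ u ≡ true

  LQ : U → List V
  LQ u = filterᵇ (λ y → not (univ y) ∧ (lev y <ᵇ lev (proj₁ u))) vars

  Strat : U → Set
  Strat u = Code (length (LQ u))

  sem : (u : U) → Strat u → (V → Bool) → Val
  sem u c α = ⟦ c ⟧ (λ i → α (lookup (LQ u) i))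

  litEq : Lit V → Lit V → Bool
  litEq (x , p) (y , q) = ⌊ x ≟V y ⌋ ∧ ⌊ p BoolP.≟ q ⌋

  falsify : U → Clause V → Val
  falsify u C with C (proj₁ u , true) | C (proj₁ u , false)
  ... | true  | _     = v0
  ... | false | true  = v1
  ... | false | false = ⋆

  resolvent : Clause V → Clause V → V → Clause V
  resolvent C D x l = (C l ∧ not (litEq l (x , true))) ∨ (D l ∧ not (litEq l (x , false)))

  record Line : Set where
    field
      clause : Clause V
      strat  : (u : U) → Strat u
  open Line public

  data Just {N : ℕ} (L : Fin N → Line) (i : Fin N) : Set where
    axiom : (c : Fin (length matrix)) →
            (∀ l → clause (L i) l ≡ (lookup matrix c l ∧ not (univ (proj₁ l)))) →
            (∀ u α → sem u (strat (L i) u) α ≡ falsify u (lookup matrix c)) →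
            Just L i
    res   : (a b : Fin N) → a Fin.< i → b Fin.< i →
            (x : V) → univ x ≡ false →
            clause (L a) (x , true) ≡ true →
            clause (L b) (x , false) ≡ true →
            (∀ l → clause (L i) l ≡ resolvent (clause (L a)) (clause (L b)) x l) →
            (∀ u →
              (lev x < lev (proj₁ u) → ∀ α →
                 sem u (strat (L i) u) α ≡
                   (if α x then sem u (strat (L b) u) α else sem u (strat (L a) u) α))
              ×
              (lev (proj₁ u) < lev x → ∀ α →
                 (sem u (strat (L a) u) α ≃v sem u (strat (L b) u) α) ×
                 (sem u (strat (L i) u) α ≡ (sem u (strat (L a) u) α ∘v sem u (strat (L b) u) α)))) →
            Just L i

  record Refutation : Set where
    field
      M     : ℕ
      lines : Fin (suc M) → Line
      justif : (i : Fin (suc M)) → Just lines i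
      empty : ∀ l → clause (lines (fromℕ M)) l ≡ false

  size : Refutation → ℕ
  size π = suc (Refutation.M π)

  module Graph (π : Refutation) where
    open Refutation π

    Node : Set
    Node = Fin (suc M)

    root : Node
    root = fromℕ M

    edgeJ : {k : Node} → Just lines k → Node → Set
    edgeJ (axiom _ _ _) i = ⊥
    edgeJ (res a b _ _ _ _ _ _ _ _) i = (a ≡ i) ⊎ (b ≡ i)

    Edge : Node → Node → Set
    Edge i k = edgeJ (justif k) i

    pivotJ : {k : Node} → Just lines k → Maybe V
    pivotJ (axiom _ _ _) = nothing
    pivotJ (res _ _ _ _ x _ _ _ _ _) = just x

    pivot : Node → Maybe V
    pivot k = pivotJ (justif k)

    Leaf : Node → Set
    Leaf l = ∀ j → ¬ Edge j l

    Path : Node → Node → Set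
    Path = Star Edge

    Path⁺ : Node → Node → Set
    Path⁺ i j = Σ Node λ k → Edge i k × Path k j

  Regular : (V → Set) → Refutation → Set
  Regular S π = ∀ x → S x → ∀ l p q →
      Leaf l → Path l p → pivot p ≡ just x →
      Path⁺ p q → pivot q ≡ just x → Path q root → ⊥
    where open Graph π

data CRVar (n : ℕ) : Set where
  xv : Fin n → Fin n → CRVar n
  zv : CRVar n
  av : Fin n → CRVar n
  bv : Fin n → CRVar n

module _ {n : ℕ} where
  private
    xv-inj₁ : ∀ {i j i' j'} → xv {n} i j ≡ xv i' j' → i ≡ i'
    xv-inj₁ refl = refl
    xv-inj₂ : ∀ {i j i' j'} → xv {n} i j ≡ xv i' j' → j ≡ j'
    xv-inj₂ refl = refl
    av-inj : ∀ {i i'} → av {n} i ≡ av i' → i ≡ i'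
    av-inj refl = refl
    bv-inj : ∀ {i i'} → bv {n} i ≡ bv i' → i ≡ i'
    bv-inj refl = refl

  _≟CR_ : DecidableEquality (CRVar n)
  xv i j ≟CR xv i' j' with i Fin.≟ i' | j Fin.≟ j'
  ... | yes refl | yes refl = yes refl
  ... | no ne    | _        = no λ e → ne (xv-inj₁ e)
  ... | yes _    | no ne    = no λ e → ne (xv-inj₂ e)
  xv _ _ ≟CR zv     = no λ ()
  xv _ _ ≟CR av _   = no λ ()
  xv _ _ ≟CR bv _   = no λ ()
  zv ≟CR xv _ _     = no λ ()
  zv ≟CR zv         = yes refl
  zv ≟CR av _       = no λ ()
  zv ≟CR bv _       = no λ ()
  av _ ≟CR xv _ _   = no λ ()
  av _ ≟CR zv       = no λ ()
  av i ≟CR av i' with i Fin.≟ i'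
  ... | yes refl = yes refl
  ... | no ne    = no λ e → ne (av-inj e)
  av _ ≟CR bv _     = no λ ()
  bv _ ≟CR xv _ _   = no λ ()
  bv _ ≟CR zv       = no λ ()
  bv _ ≟CR av _     = no λ ()
  bv i ≟CR bv i' with i Fin.≟ i'
  ... | yes refl = yes refl
  ... | no ne    = no λ e → ne (bv-inj e)

_==ᶠ_ : ∀ {n} → Fin n → Fin n → Bool
i ==ᶠ j = ⌊ i Fin.≟ j ⌋

clauseA : ∀ {n} → Fin n → Fin n → Clause (CRVar n)
clauseA i j (xv i' j' , true) = (i' ==ᶠ i) ∧ (j' ==ᶠ j)
clauseA i j (zv , true)       = true
clauseA i j (av i' , true)    = i' ==ᶠ i
clauseA i j _                 = false

clauseB : ∀ {n} → Fin n → Fin n → Clause (CRVar n)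
clauseB i j (xv i' j' , false) = (i' ==ᶠ i) ∧ (j' ==ᶠ j)
clauseB i j (zv , false)       = true
clauseB i j (bv j' , true)     = j' ==ᶠ j
clauseB i j _                  = false

clauseLA : ∀ {n} → Clause (CRVar n)
clauseLA (av _ , false) = true
clauseLA _              = false

clauseLB : ∀ {n} → Clause (CRVar n)
clauseLB (bv _ , false) = true
clauseLB _              = false

levCR : ∀ {n} → CRVar n → ℕ
levCR (xv _ _) = 0
levCR zv       = 1
levCR (av _)   = 2
levCR (bv _)   = 3

univCR : ∀ {n} → CRVar n → Bool
univCR zv = true
univCR _  = false

CR : ℕ → QBF
CR n = record
  { V      = CRVar n
  ; _≟V_   = _≟CR_
  ; vars   = concatMap (λ i → map (xv i) (allFin n)) (allFin n)
             ++ zv ∷ map av (allFin n) ++ map bv (allFin n)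
  ; lev    = levCR
  ; univ   = univCR
  ; matrix = concatMap (λ i → concatMap (λ j → clauseA i j ∷ clauseB i j ∷ []) (allFin n)) (allFin n)
             ++ clauseLA ∷ clauseLB ∷ []
  }

InAB : ∀ {n} → CRVar n → Set
InAB (av _) = ⊤
InAB (bv _) = ⊤
InAB _      = ⊥

{-# OPTIONS --safe #-}
-- Every total assignment α to the x-variables leads from the root, through x-pivots
-- only, up to a line whose clause C contains only x-literals, is falsified by α, and is
-- derived by resolving an a- or b-variable. Such a C has width at least n − 1, so a union
-- bound over all α gives 2 ^ (n − 1) such lines.
--
-- For the width, let the pivot be a_κ and P the premise containing it. An occurrence of
-- L_A above P would force a_κ to be resolved twice on a path, so no a-variable is
-- resolved above P, hence only axioms A_κj occur there among the A_ij, and the strategy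
-- at P depends only on row κ. Suppose that C mentions no variable of a row i ≠ κ and has no
-- negative literal in column j. Among the assignments falsifying C and zero on column j
-- outside row i, one with row i full makes the universal response at C equal to 1, one
-- with row i empty makes the response at P equal to 0; but both are the value at P,
-- up to ⋆. The case of a b-pivot is dual.
module Submission where

open import Defs
open import Data.Bool using (Bool; true; false; not; _∧_; _∨_; if_then_else_)
import Data.Bool.Properties as Bool
open import Data.Nat using (ℕ; zero; suc; _+_; _*_; _^_; _≤_; z≤n; s≤s; _≤?_; NonZero)
import Data.Nat as ℕ
open import Data.Nat.Properties hiding (_≟_; _≤?_)
open import Data.Fin using (Fin; zero; suc; punchIn; _≟_; _<_)
open import Data.Fin.Properties using (any?; all?; ¬∀⟶∃¬; punchInᵢ≢i)
open import Data.Fin.Induction using (<-wellFounded)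
open import Data.List using ([]; _∷_; concatMap; allFin)
open import Data.List.Membership.Propositional using (_∈_; find)
open import Data.List.Membership.Propositional.Properties using (∈-++⁻; ∈-concatMap⁻; ∈-lookup)
open import Data.List.Relation.Unary.Any using (here; there)
open import Data.Maybe using (Maybe; just; nothing)
open import Data.Maybe.Properties using (just-injective)
open import Data.Product using (Σ; ∃; ∃₂; _×_; _,_; proj₁; proj₂; map₂)
open import Data.Sum as Sum using (_⊎_; inj₁; inj₂; fromInj₂)
open import Data.Vec using (Vec; []; _∷_; lookup)
open import Data.Unit using (⊤)
open import Data.Empty using (⊥; ⊥-elim)
open import Function using (_∘_)
open import Induction.WellFounded using (Acc; acc)
open import Relation.Nullary using (¬_; Dec; yes; no)
open import Relation.Nullary.Decidable using (⌊_⌋; _⊎-dec_)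
open import Relation.Binary.PropositionalEquality
open import Relation.Binary.Construct.Closure.ReflexiveTransitive using (ε; _◅_; _◅◅_)
open import Algebra.Properties.CommutativeMonoid.Sum +-0-commutativeMonoid using (sum; sum-remove; ∑-comm)
open import Algebra.Properties.Semiring.Sum +-*-semiring using (*-distribʳ-sum)
open import Algebra.Properties.CommutativeSemigroup +-commutativeSemigroup using (interchange)

-- Finite sums, abstract summation operators and densities.

private variable
  A : Set

true≢false : true ≢ false
true≢false ()

sum-mono : ∀ {n} {f g : Fin n → ℕ} → (∀ i → f i ≤ g i) → sum f ≤ sum g
sum-mono {zero}  f≤g = z≤n
sum-mono {suc n} f≤g = +-mono-≤ (f≤g zero) (sum-mono (f≤g ∘ suc))

sum-const : ∀ n c → sum {n} (λ _ → c) ≡ n * c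
sum-const zero    c = refl
sum-const (suc n) c = cong (c +_) (sum-const n c)

term≤sum : ∀ {n} (f : Fin n → ℕ) i → f i ≤ sum f
term≤sum {suc n} f i = subst (f i ≤_) (sym (sum-remove {i = i} f)) (m≤m+n _ _)

sum-≥-all-but-one : ∀ {n} (f : Fin (suc n) → ℕ) k → (∀ i → i ≢ k → 1 ≤ f i) → n ≤ sum f
sum-≥-all-but-one {n} f k 1≤f = begin
  n                              ≡⟨ trans (sym (*-identityʳ n)) (sym (sum-const n 1)) ⟩
  sum {n} (λ _ → 1)              ≤⟨ sum-mono (λ i → 1≤f (punchIn k i) (punchInᵢ≢i k i)) ⟩
  sum (f ∘ punchIn k)            ≤⟨ m≤n+m _ (f k) ⟩
  f k + sum (f ∘ punchIn k)      ≡⟨ sym (sum-remove {i = k} f) ⟩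
  sum f                          ∎
  where open ≤-Reasoning

Summation : Set → Set
Summation A = (A → ℕ) → ℕ

-- Linearity, monotonicity and the total mass `T` are all that the counting argument needs of a sum,
-- so assignments never have to be enumerated.
record IsSum (S : Summation A) (T : ℕ) : Set where
  field
    mono  : ∀ {f g} → (∀ a → f a ≤ g a) → S f ≤ S g
    add   : ∀ f g → S (λ a → f a + g a) ≡ S f + S g
    scale : ∀ f c → S (λ a → f a * c) ≡ S f * c
    total : S (λ _ → 1) ≡ T

  vanish : ∀ {f} → (∀ a → f a ≡ 0) → S f ≡ 0
  vanish {f} f≡0 = n≤0⇒n≡0 (begin
    S f               ≤⟨ mono (λ a → ≤-reflexive (trans (f≡0 a) (sym (*-zeroʳ (f a))))) ⟩
    S (λ a → f a * 0) ≡⟨ trans (scale f 0) (*-zeroʳ (S f)) ⟩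
    0                 ∎)
    where open ≤-Reasoning

  exchange : ∀ {n} (f : Fin n → A → ℕ) → S (λ a → sum (λ i → f i a)) ≡ sum (λ i → S (f i))
  exchange {zero}  f = vanish (λ _ → refl)
  exchange {suc n} f = trans (add (f zero) _) (cong (S (f zero) +_) (exchange (f ∘ suc)))

open IsSum

-- P has density at most 1 / c; stated for weighted f so that it iterates over the coordinates of a vector.
Sparse : Summation A → ℕ → (A → Set) → ℕ → Set
Sparse {A} S T P c = ∀ (f : A → ℕ) K → (∀ a → f a ≤ K) → (∀ a → ¬ P a → f a ≡ 0) → S f * c ≤ K * T

boolSum : Summation Bool
boolSum f = f true + f false

boolSum-isSum : IsSum boolSum 2
boolSum-isSum = record
  { mono  = λ f≤g → +-mono-≤ (f≤g true) (f≤g false)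
  ; add   = λ f g → interchange (f true) (g true) (f false) (g false)
  ; scale = λ f c → sym (*-distribʳ-+ c (f true) (f false))
  ; total = refl
  }

vecSum : Summation A → ∀ n → Summation (Vec A n)
vecSum S zero    f = f []
vecSum S (suc n) f = S (λ a → vecSum S n (λ v → f (a ∷ v)))

S-cong : ∀ {S : Summation A} {T} → IsSum S T → ∀ {f g} → (∀ a → f a ≡ g a) → S f ≡ S g
S-cong s f≡g = ≤-antisym (mono s (λ a → ≤-reflexive (f≡g a))) (mono s (λ a → ≤-reflexive (sym (f≡g a))))

vecSum-isSum : ∀ {S : Summation A} {T} → IsSum S T → ∀ n → IsSum (vecSum S n) (T ^ n)
vecSum-isSum s zero = record
  { mono = λ f≤g → f≤g [] ; add = λ _ _ → refl ; scale = λ _ _ → refl ; total = refl }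
vecSum-isSum {S = S} {T} s (suc n) = record
  { mono  = λ f≤g → mono s (λ a → mono r (λ v → f≤g (a ∷ v)))
  ; add   = λ f g → trans (S-cong s (λ a → add r _ _)) (add s _ _)
  ; scale = λ f c → trans (S-cong s (λ a → scale r _ c)) (scale s _ c)
  ; total = trans (S-cong s (λ a → trans (total r) (sym (*-identityˡ _))))
                  (trans (scale s (λ _ → 1) (T ^ n)) (cong (_* T ^ n) (total s)))
  }
  where r = vecSum-isSum s n

-- Conditions on distinct coordinates are independent, so their densities multiply and the exponents
-- add.
vecSum-sparse : ∀ {S : Summation A} {T} → IsSum S T → ∀ {n} {P : Fin n → A → Set} {e : Fin n → ℕ} →
  (∀ i → Sparse S T (P i) (2 ^ e i)) →
  Sparse (vecSum S n) (T ^ n) (λ v → ∀ i → P i (lookup v i)) (2 ^ sum e)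
vecSum-sparse s {zero} sp f K f≤K _ = *-monoˡ-≤ 1 (f≤K [])
vecSum-sparse {A = A} {S} {T} s {suc n} {P} {e} sp f K f≤K f≡0 = begin
  S g * 2 ^ (e zero + sum e′)       ≡⟨ cong (S g *_) (trans (^-distribˡ-+-* 2 (e zero) (sum e′)) (*-comm (2 ^ e zero) _)) ⟩
  S g * (2 ^ sum e′ * 2 ^ e zero)   ≡⟨ sym (*-assoc (S g) _ _) ⟩
  S g * 2 ^ sum e′ * 2 ^ e zero     ≡⟨ cong (_* 2 ^ e zero) (sym (scale s g _)) ⟩
  S (λ a → g a * 2 ^ sum e′) * 2 ^ e zero
    -- The tail sum, scaled by `2 ^ sum e′`, acts as the weight on the head; the induction
    -- hypothesis bounds it by `K * T ^ n`.
    ≤⟨ sp zero _ (K * T ^ n)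
         (λ a → vecSum-sparse s (sp ∘ suc) (λ v → f (a ∷ v)) K (λ v → f≤K (a ∷ v))
                  (λ v ¬p → f≡0 (a ∷ v) (λ p → ¬p (p ∘ suc))))
         (λ a ¬p → cong (_* 2 ^ sum e′)
                     (vanish (vecSum-isSum s n) (λ v → f≡0 (a ∷ v) (λ p → ¬p (p zero))))) ⟩
  K * T ^ n * T                     ≡⟨ trans (*-assoc K _ T) (cong (K *_) (*-comm (T ^ n) T)) ⟩
  K * (T * T ^ n)                   ∎
  where
  open ≤-Reasoning
  e′ = e ∘ suc
  g : A → ℕ
  g a = vecSum S n (λ v → f (a ∷ v))

Agrees : Maybe Bool → Bool → Set
Agrees ρ b = ∀ c → ρ ≡ just c → b ≡ c

∣_∣ : Maybe Bool → ℕ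
∣ just _ ∣  = 1
∣ nothing ∣ = 0

boolSum-sparse : ∀ ρ → Sparse boolSum 2 (Agrees ρ) (2 ^ ∣ ρ ∣)
boolSum-sparse nothing f K f≤K _ = begin
  (f true + f false) * 1 ≡⟨ *-identityʳ _ ⟩
  f true + f false       ≤⟨ +-mono-≤ (f≤K true) (f≤K false) ⟩
  K + K                  ≡⟨ trans (cong (K +_) (sym (+-identityʳ K))) (*-comm 2 K) ⟩
  K * 2                  ∎
  where open ≤-Reasoning
boolSum-sparse (just true) f K f≤K f≡0 =
  *-monoˡ-≤ 2 (≤-trans (≤-reflexive (trans (cong (f true +_) (f≡0 false (λ p → true≢false (sym (p true refl))))) (+-identityʳ _))) (f≤K true))
boolSum-sparse (just false) f K f≤K f≡0 =
  *-monoˡ-≤ 2 (≤-trans (≤-reflexive (cong (_+ f false) (f≡0 true (λ p → true≢false (p false refl))))) (f≤K false))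

-- Boolean grids and the union bound.

Grid : ℕ → Set
Grid n = Vec (Vec Bool n) n

entry : ∀ {n} → Grid n → Fin n → Fin n → Bool
entry m i j = lookup (lookup m i) j

PartialGrid : ℕ → Set
PartialGrid n = Fin n → Fin n → Maybe Bool

width : ∀ {n} → PartialGrid n → ℕ
width ρ = sum (λ i → sum (λ j → ∣ ρ i j ∣))

private
  δ : ∀ {n} → Fin n → Fin n → ℕ
  δ i j with i ≟ j
  ... | yes _ = 1
  ... | no  _ = 0

  δ≤1 : ∀ {n} (i j : Fin n) → δ i j ≤ 1
  δ≤1 i j with i ≟ j
  ... | yes _ = s≤s z≤n
  ... | no  _ = z≤n

  δ-refl : ∀ {n} (i : Fin n) → δ i i ≡ 1
  δ-refl i with i ≟ i
  ... | yes _ = refl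
  ... | no i≢i = ⊥-elim (i≢i refl)

  δ-≢ : ∀ {n} {i j : Fin n} → i ≢ j → δ i j ≡ 0
  δ-≢ {i = i} {j} i≢j with i ≟ j
  ... | yes i≡j = ⊥-elim (i≢j i≡j)
  ... | no _ = refl

-- Union bound: a partial grid of width at least w agrees with at most a 2 ^ - w fraction of all grids.
cover-bound : ∀ {n N} w (node : Grid n → Fin N) (ρ : Fin N → PartialGrid n) →
  (∀ m i j → Agrees (ρ (node m) i j) (entry m i j)) →
  (∀ m → w ≤ width (ρ (node m))) →
  2 ^ w ≤ N
cover-bound {n} {N} w node ρ agrees wide = *-cancelʳ-≤ (2 ^ w) N T {{T≢0}} (begin
  2 ^ w * T                              ≡⟨ *-comm (2 ^ w) T ⟩
  T * 2 ^ w                              ≡⟨ cong (_* 2 ^ w) (sym (total s)) ⟩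
  G (λ _ → 1) * 2 ^ w                    ≤⟨ *-monoˡ-≤ (2 ^ w) (mono s hit) ⟩
  G (λ m → sum (λ c → f c m)) * 2 ^ w    ≡⟨ cong (_* 2 ^ w) (exchange s f) ⟩
  sum (λ c → G (f c)) * 2 ^ w            ≡⟨ *-distribʳ-sum (2 ^ w) (G ∘ f) ⟩
  sum (λ c → G (f c) * 2 ^ w)            ≤⟨ sum-mono fibre ⟩
  sum {N} (λ _ → T)                      ≡⟨ sum-const N T ⟩
  N * T                                  ∎)
  where
  open ≤-Reasoning
  G = vecSum (vecSum boolSum n) n
  T = (2 ^ n) ^ n
  T≢0 : NonZero T
  T≢0 = m^n≢0 (2 ^ n) n {{m^n≢0 2 n}}
  row = vecSum-isSum boolSum-isSum n
  s = vecSum-isSum row n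
  f : Fin N → Grid n → ℕ
  f c m = δ (node m) c

  hit : ∀ m → 1 ≤ sum (λ c → f c m)
  hit m = ≤-trans (≤-reflexive (sym (δ-refl (node m)))) (term≤sum (λ c → f c m) (node m))

  fibre : ∀ c → G (f c) * 2 ^ w ≤ T
  fibre c with w ≤? width (ρ c)
  ... | yes w≤ρ = begin
    G (f c) * 2 ^ w           ≤⟨ *-monoʳ-≤ (G (f c)) (^-monoʳ-≤ 2 w≤ρ) ⟩
    G (f c) * 2 ^ width (ρ c) ≤⟨ vecSum-sparse row
                                   (λ i → vecSum-sparse boolSum-isSum (λ j → boolSum-sparse (ρ c i j)))
                                   (f c) 1 (λ m → δ≤1 (node m) c)
                                   (λ m ¬p → δ-≢ (λ { refl → ¬p (agrees m) })) ⟩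
    1 * T                     ≡⟨ *-identityˡ T ⟩
    T                         ∎
  -- By `wide`, a node with too narrow a partial grid is the image of no grid, so its fibre is
  -- empty.
  ... | no w≰ρ = begin
    G (f c) * 2 ^ w ≡⟨ cong (_* 2 ^ w) (vanish s {f c} (λ m → δ-≢ (λ { refl → w≰ρ (wide m) }))) ⟩
    0               ≤⟨ z≤n ⟩
    T               ∎

∧-true : ∀ {a b} → a ∧ b ≡ true → a ≡ true × b ≡ true
∧-true {true} {true} _ = refl , refl

∨-true : ∀ {a b} → a ∨ b ≡ true → a ≡ true ⊎ b ≡ true
∨-true {true}  _ = inj₁ refl
∨-true {false} e = inj₂ e

⌊⌋-true : ∀ {P : Set} (p? : Dec P) → ⌊ p? ⌋ ≡ true → P
⌊⌋-true (yes p) _ = p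

==ᶠ-refl : ∀ {n} (i : Fin n) → (i ==ᶠ i) ≡ true
==ᶠ-refl i with i ≟ i
... | yes _  = refl
... | no i≢i = ⊥-elim (i≢i refl)

-- Side true is the a-side and side false the b-side. Indices on the b-side are
-- transposed, so that on either side `own s i` is the variable forced by row i.
own : ∀ {n} → Bool → Fin n → CRVar n
own true  = av
own false = bv

cell : ∀ {n} → Bool → Fin n → Fin n → CRVar n
cell true  i j = xv i j
cell false i j = xv j i

data SideView {n} (s : Bool) : CRVar n → Set where
  cellV  : ∀ i j → SideView s (cell s i j)
  zV     : SideView s zv
  ownV   : ∀ i → SideView s (own s i)
  otherV : ∀ i → SideView s (own (not s) i)

sideView : ∀ {n} s (v : CRVar n) → SideView s v
sideView true  (xv i j) = cellV i j
sideView false (xv i j) = cellV j i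
sideView true  zv       = zV
sideView false zv       = zV
sideView true  (av i)   = ownV i
sideView false (av i)   = otherV i
sideView true  (bv i)   = otherV i
sideView false (bv i)   = ownV i

assignment : ∀ {n} → Bool → (Fin n → Fin n → Bool) → (Fin n → Bool) → (Fin n → Bool) → CRVar n → Bool
assignment true  x o o′ (xv i j) = x i j
assignment false x o o′ (xv i j) = x j i
assignment s     x o o′ zv       = false
assignment true  x o o′ (av i)   = o i
assignment false x o o′ (av i)   = o′ i
assignment true  x o o′ (bv i)   = o′ i
assignment false x o o′ (bv i)   = o i

module _ {n : ℕ} (x : Fin n → Fin n → Bool) (o o′ : Fin n → Bool) where

  assignment-cell : ∀ s i j → assignment s x o o′ (cell s i j) ≡ x i j
  assignment-cell true  i j = refl
  assignment-cell false i j = refl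

  assignment-cell′ : ∀ s i j → assignment s x o o′ (cell (not s) i j) ≡ x j i
  assignment-cell′ true  i j = refl
  assignment-cell′ false i j = refl

  assignment-own : ∀ s i → assignment s x o o′ (own s i) ≡ o i
  assignment-own true  i = refl
  assignment-own false i = refl

  assignment-other : ∀ s i → assignment s x o o′ (own (not s) i) ≡ o′ i
  assignment-other true  i = refl
  assignment-other false i = refl

-- Axioms of the completion formulas, indexed by side.

data Axiom (n : ℕ) : Set where
  small : Bool → Fin n → Fin n → Axiom n
  big   : Bool → Axiom n

-- The swapped indices in `clauseB j i` make the existential literals of `small s i j` uniform in
-- `s`: `cell s i j` with polarity `s`, and `own s i` positive.
fullClause : ∀ {n} → Axiom n → Clause (CRVar n)
fullClause (small true  i j) = clauseA i j
fullClause (small false i j) = clauseB j i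
fullClause (big true)        = clauseLA
fullClause (big false)       = clauseLB

∃clause : ∀ {n} → Axiom n → Clause (CRVar n)
∃clause r l = fullClause r l ∧ not (univCR (proj₁ l))

-- The a-side clauses contain z positively and the b-side clauses negatively; these are the values
-- that falsify that literal.
sideVal : Bool → Val
sideVal true  = v0
sideVal false = v1

axiomVal : ∀ {n} → Axiom n → Val
axiomVal (small s _ _) = sideVal s
axiomVal (big _)       = ⋆

∈-matrix : ∀ {n C} → C ∈ QBF.matrix (CR n) → ∃ λ r → C ≡ fullClause r
∈-matrix {n} {C} C∈
  with ∈-++⁻ (concatMap (λ i → concatMap (λ j → clauseA i j ∷ clauseB i j ∷ []) (allFin n)) (allFin n)) C∈
... | inj₂ (here C≡)         = big true , C≡
... | inj₂ (there (here C≡)) = big false , C≡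
... | inj₁ C∈s with find (∈-concatMap⁻ _ {xs = allFin n} C∈s)
... | i , _ , C∈i with find (∈-concatMap⁻ _ {xs = allFin n} C∈i)
... | j , _ , here C≡         = small true i j , C≡
... | j , _ , there (here C≡) = small false j i , C≡

cell∈small : ∀ {n} s (i j : Fin n) → ∃clause (small s i j) (cell s i j , s) ≡ true
cell∈small true  i j rewrite ==ᶠ-refl i | ==ᶠ-refl j = refl
cell∈small false i j rewrite ==ᶠ-refl i | ==ᶠ-refl j = refl

own∈small : ∀ {n} s (i j : Fin n) → ∃clause (small s i j) (own s i , true) ≡ true
own∈small true  i j rewrite ==ᶠ-refl i = refl
own∈small false i j rewrite ==ᶠ-refl i = refl

own∈big : ∀ {n} s (i : Fin n) → ∃clause (big s) (own s i , false) ≡ true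
own∈big true  i = refl
own∈big false i = refl

own-only-in-big : ∀ {n} s {i : Fin n} r → ∃clause r (own s i , false) ≡ true → r ≡ big s
own-only-in-big true  (big true)          _ = refl
own-only-in-big false (big false)         _ = refl
own-only-in-big true  (small true _ _)    ()
own-only-in-big true  (small false _ _)   ()
own-only-in-big false (small true _ _)    ()
own-only-in-big false (small false _ _)   ()
own-only-in-big true  (big false)         ()
own-only-in-big false (big true)          ()

cell-only-in-small : ∀ {n} s {i j : Fin n} r → ∃clause r (cell s i j , s) ≡ true → r ≡ small s i j
cell-only-in-small true {i} {j} (small true i′ j′) e with ∧-true (proj₁ (∧-true e))
... | i≡ , j≡ = sym (cong₂ (small true) (⌊⌋-true (i ≟ i′) i≡) (⌊⌋-true (j ≟ j′) j≡))
cell-only-in-small false {i} {j} (small false i′ j′) e with ∧-true (proj₁ (∧-true e))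
... | j≡ , i≡ = sym (cong₂ (small false) (⌊⌋-true (i ≟ i′) i≡) (⌊⌋-true (j ≟ j′) j≡))
cell-only-in-small true  (small false _ _) ()
cell-only-in-small true  (big true)        ()
cell-only-in-small true  (big false)       ()
cell-only-in-small false (small true _ _)  ()
cell-only-in-small false (big true)        ()
cell-only-in-small false (big false)       ()

own-injective : ∀ {n} s {i j : Fin n} → own s i ≡ own s j → i ≡ j
own-injective true  refl = refl
own-injective false refl = refl

inAB-own : ∀ {n} s (i : Fin n) → InAB (own s i)
inAB-own true  i = _
inAB-own false i = _

-- Falsified clauses and the order on strategy values.

Falsifies : ∀ {V : Set} → (V → Bool) → Clause V → Set
Falsifies τ C = ∀ v b → C (v , b) ≡ true → τ v ≡ not b

-- The information order with ⋆ at the bottom; unlike `≃v` it is directed.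
Compatible : Val → Val → Set
Compatible v w = v ≡ ⋆ ⊎ v ≡ w

∘v-left : ∀ {u v w} → v ≃v w → Compatible u v → Compatible u (v ∘v w)
∘v-left {v = v0} _ c = c
∘v-left {v = v1} _ c = c
∘v-left {v = ⋆}  _ (inj₁ e) = inj₁ e
∘v-left {v = ⋆}  _ (inj₂ e) = inj₁ e

-- Composition prefers its left operand; consistency ensures that the right one is not overridden by
-- a different value.
∘v-right : ∀ {u v w} → v ≃v w → Compatible u w → Compatible u (v ∘v w)
∘v-right {v = ⋆} _ c = c
∘v-right _ (inj₁ e) = inj₁ e
∘v-right {v = v0} {v0} _ (inj₂ e) = inj₂ e
∘v-right {v = v0} {⋆}  _ (inj₂ e) = inj₁ e
∘v-right {v = v1} {v1} _ (inj₂ e) = inj₂ e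
∘v-right {v = v1} {⋆}  _ (inj₂ e) = inj₁ e

∘v-⋆ : ∀ {v w} → Compatible v (v ∘v w)
∘v-⋆ {v0} = inj₂ refl
∘v-⋆ {v1} = inj₂ refl
∘v-⋆ {⋆}  = inj₁ refl

IsCell : ∀ {n} → CRVar n → Set
IsCell (xv _ _) = ⊤
IsCell _        = ⊥

¬isCell-own : ∀ {n} s {i : Fin n} → ¬ IsCell (own s i)
¬isCell-own true  ()
¬isCell-own false ()

lev-own : ∀ {n} s {i : Fin n} → 1 ℕ.< levCR (own s i)
lev-own true  = s≤s (s≤s z≤n)
lev-own false = s≤s (s≤s z≤n)

lev-cases : ∀ {n} (v : CRVar n) → univCR v ≡ false → levCR v ℕ.< 1 ⊎ 1 ℕ.< levCR v
lev-cases (xv _ _) _ = inj₁ (s≤s z≤n)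
lev-cases (av _)   _ = inj₂ (s≤s (s≤s z≤n))
lev-cases (bv _)   _ = inj₂ (s≤s (s≤s z≤n))

side-cases : ∀ t s → t ≡ s ⊎ t ≡ not s
side-cases true  true  = inj₁ refl
side-cases true  false = inj₂ refl
side-cases false true  = inj₂ refl
side-cases false false = inj₁ refl

not-==ᶠ : ∀ {n} (i j : Fin n) → not (i ==ᶠ j) ≡ false → i ≡ j
not-==ᶠ i j e = ⌊⌋-true (i ≟ j) (Bool.not-injective e)

-- Structure of refutations: literals along paths.

module Refuted {R : Representation} {n : ℕ} (π : MRes.Refutation (CR n) R)
               (regular : MRes.Regular (CR n) R InAB π) where

  open MRes (CR n) R
  open Refutation π
  open Graph π

  Var : Set
  Var = CRVar n

  C : Node → Clause Var
  C k = clause (lines k)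

  H : Node → (Var → Bool) → Val
  H k τ = sem (zv , refl) (strat (lines k) (zv , refl)) τ

  litEq-true : ∀ {l m} → litEq l m ≡ true → l ≡ m
  litEq-true {x , p} {y , q} e with ∧-true e
  ... | x≡y , p≡q = cong₂ _,_ (⌊⌋-true (x ≟CR y) x≡y) (⌊⌋-true (p Bool.≟ q) p≡q)

  -- Premises are indexed by the polarity of the pivot literal in them. The premise whose pivot
  -- literal τ falsifies is then `prem (not (τ x))`, and a merge on the pivot selects the strategy
  -- value of this same premise.
  record Resolution {k : Node} (J : Just lines k) : Set where
    field
      x       : Var
      prem    : Bool → Node
      edge    : ∀ b → edgeJ J (prem b)
      prem<   : ∀ b → prem b < k
      prems   : ∀ {i} → edgeJ J i → ∃ λ b → i ≡ prem b
      pivot≡  : pivotJ J ≡ just x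
      x-exist : univCR x ≡ false
      x∈prem  : ∀ b → C (prem b) (x , b) ≡ true
      kept    : ∀ b l → C (prem b) l ≡ true → l ≡ (x , b) ⊎ C k l ≡ true
      H-merge : levCR x ℕ.< 1 → ∀ τ → H k τ ≡ H (prem (not (τ x))) τ
      H-join  : 1 ℕ.< levCR x → ∀ τ → (H (prem true) τ ≃v H (prem false) τ) ×
                                      (H k τ ≡ H (prem true) τ ∘v H (prem false) τ)
      origin  : ∀ l → C k l ≡ true → ∃ λ b → C (prem b) l ≡ true

  data View {k : Node} (J : Just lines k) : Set where
    isAxiom : ∀ r → (∀ l → C k l ≡ ∃clause r l) → (∀ τ → H k τ ≡ axiomVal r) →
              (∀ j → ¬ edgeJ J j) → pivotJ J ≡ nothing → View J
    isRes   : Resolution J → View J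

  falsify-axiom : ∀ r → falsify (zv , refl) (fullClause r) ≡ axiomVal r
  falsify-axiom (small true  _ _) = refl
  falsify-axiom (small false _ _) = refl
  falsify-axiom (big true)        = refl
  falsify-axiom (big false)       = refl

  view : ∀ {k} (J : Just lines k) → View J
  view (axiom c C≡ H≡) with ∈-matrix {n} (∈-lookup {xs = QBF.matrix (CR n)} c)
  ... | r , c≡r = isAxiom r (λ l → trans (C≡ l) (cong (λ D → D l ∧ not (univCR (proj₁ l))) c≡r))
                    (λ τ → trans (H≡ (zv , refl) τ) (trans (cong (falsify (zv , refl)) c≡r) (falsify-axiom r)))
                    (λ _ ()) refl
  view {k} (res a b a<k b<k x ex x∈a x∈b C≡ H≡) = isRes record
    { x       = x
    ; prem    = prem
    ; edge    = λ { true → inj₁ refl ; false → inj₂ refl }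
    ; prem<   = λ { true → a<k ; false → b<k }
    ; prems   = λ { (inj₁ e) → true , sym e ; (inj₂ e) → false , sym e }
    ; pivot≡  = refl
    ; x-exist = ex
    ; x∈prem  = λ { true → x∈a ; false → x∈b }
    ; kept    = kept
    ; H-merge = λ x<z τ → trans (proj₁ (H≡ (zv , refl)) x<z τ) (branch τ (τ x))
    ; H-join  = proj₂ (H≡ (zv , refl))
    ; origin  = origin
    }
    where
    prem : Bool → Node
    prem true  = a
    prem false = b
    branch : ∀ τ t → (if t then H b τ else H a τ) ≡ H (prem (not t)) τ
    branch τ true  = refl
    branch τ false = refl
    kept : ∀ p l → C (prem p) l ≡ true → l ≡ (x , p) ⊎ C k l ≡ true
    kept true l l∈ with litEq l (x , true) in eq
    ... | true  = inj₁ (litEq-true eq)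
    ... | false rewrite C≡ l | l∈ | eq = inj₂ refl
    kept false l l∈ with litEq l (x , false) in eq
    ... | true  = inj₁ (litEq-true eq)
    ... | false rewrite C≡ l | l∈ | eq = inj₂ (Bool.∨-zeroʳ _)
    origin : ∀ l → C k l ≡ true → ∃ λ p → C (prem p) l ≡ true
    origin l l∈ with ∨-true (trans (sym (C≡ l)) l∈)
    ... | inj₁ e = true , proj₁ (∧-true e)
    ... | inj₂ e = false , proj₁ (∧-true e)

  edge-< : ∀ {i k} → Edge i k → i < k
  edge-< {i} {k} e with view (justif k)
  ... | isAxiom _ _ _ leaf _ = ⊥-elim (leaf i e)
  ... | isRes r with Resolution.prems r e
  ...   | b , refl = Resolution.prem< r b

  node-induction : (P : Node → Set) → (∀ k → (∀ {i} → Edge i k → P i) → P k) → ∀ k → P k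
  node-induction P step k = go k (<-wellFounded k)
    where
    go : ∀ k → Acc _<_ k → P k
    go k (acc rs) = step k (λ {i} e → go i (rs (edge-< e)))

  snoc⁺ : ∀ {i j k} → Path i j → Edge j k → Path⁺ i k
  snoc⁺ ε        e = _ , e , ε
  snoc⁺ (e′ ◅ p) e = _ , e′ , p ◅◅ (e ◅ ε)

  AxiomNode : Node → Axiom n → Set
  AxiomNode j r = (∀ l → C j l ≡ ∃clause r l) × Leaf j

  -- Resolution introduces no literal, so every literal can be followed upward to an axiom.
  source : ∀ k l → C k l ≡ true → ∃₂ λ j r → Path j k × AxiomNode j r × ∃clause r l ≡ true
  source = node-induction _ step
    where
    step : ∀ k → (∀ {i} → Edge i k → ∀ l → C i l ≡ true → ∃₂ λ j r → Path j i × AxiomNode j r × ∃clause r l ≡ true) →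
           ∀ l → C k l ≡ true → ∃₂ λ j r → Path j k × AxiomNode j r × ∃clause r l ≡ true
    step k ih l l∈ with view (justif k)
    ... | isAxiom r C≡ _ leaf _ = k , r , ε , (C≡ , leaf) , trans (sym (C≡ l)) l∈
    ... | isRes r with Resolution.origin r l l∈
    ...   | b , l∈b with ih (Resolution.edge r b) l l∈b
    ...     | j , a , path , rest = j , a , path ◅◅ (Resolution.edge r b ◅ ε) , rest

  pivot-resolution : ∀ {k x} → pivot k ≡ just x → Σ (Resolution (justif k)) λ r → Resolution.x r ≡ x
  pivot-resolution {k} eq with view (justif k)
  ... | isAxiom _ _ _ _ nothing≡ with () ← trans (sym nothing≡) eq
  ... | isRes r = r , just-injective (trans (sym (Resolution.pivot≡ r)) eq)

  -- Followed downward, a literal persists until some node pivots on its variable.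
  trace : ∀ {j k} → Path j k → ∀ l → C j l ≡ true →
          C k l ≡ true ⊎ ∃ λ q → Path j q × pivot q ≡ just (proj₁ l) × Path q k
  trace ε l l∈ = inj₁ l∈
  trace {j} (_◅_ {j = m} e path) l l∈ with view (justif m)
  ... | isAxiom _ _ _ leaf _ = ⊥-elim (leaf j e)
  ... | isRes r with Resolution.prems r e
  ...   | b , refl with Resolution.kept r b l l∈
  ...     | inj₁ refl = inj₂ (m , e ◅ ε , Resolution.pivot≡ r , path)
  ...     | inj₂ l∈m with trace path l l∈m
  ...       | inj₁ l∈k             = inj₁ l∈k
  ...       | inj₂ (q , j→q , rest) = inj₂ (q , e ◅ j→q , rest)

  -- Soundness along the falsified branch.

  module _ {k} {J : Just lines k} (r : Resolution J) (τ : Var → Bool) where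
    open Resolution r

    falsifies-premise : Falsifies τ (C k) → Falsifies τ (C (prem (not (τ x))))
    falsifies-premise fals v b v∈ with kept _ (v , b) v∈
    ... | inj₁ refl = sym (Bool.not-involutive (τ x))
    ... | inj₂ v∈k  = fals v b v∈k

    compatible-join : ∀ {u} b → 1 ℕ.< levCR x → Compatible u (H (prem b) τ) → Compatible u (H k τ)
    compatible-join true  z<x c with H-join z<x τ
    ... | v≃w , eq = subst (Compatible _) (sym eq) (∘v-left v≃w c)
    compatible-join false z<x c with H-join z<x τ
    ... | v≃w , eq = subst (Compatible _) (sym eq) (∘v-right v≃w c)

    -- For a pivot left of z the merge selects exactly this premise's value; for one right of z the
    -- composition can only refine it.
    compatible-step : ∀ {u} → Compatible u (H (prem (not (τ x))) τ) → Compatible u (H k τ)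
    compatible-step c with lev-cases x x-exist
    ... | inj₁ x<z = subst (Compatible _) (sym (H-merge x<z τ)) c
    ... | inj₂ z<x = compatible-join _ z<x c

  Sound : (Var → Bool) → Node → Set
  Sound τ k = Falsifies τ (C k) → ∃ λ a → Falsifies τ (∃clause a) × Compatible (axiomVal a) (H k τ)

  -- Climbing to the falsified premise at every step ends at an axiom whose existential part τ
  -- falsifies. Its z-literal, if any, is falsified by the response at `k`, since values are only
  -- refined on the way down.
  sound : ∀ τ k → Sound τ k
  sound τ = node-induction (Sound τ) step
    where
    step : ∀ k → (∀ {i} → Edge i k → Sound τ i) → Sound τ k
    step k ih fals with view (justif k)
    ... | isAxiom a C≡ H≡ _ _ = a , (λ v b v∈ → fals v b (trans (C≡ _) v∈)) , inj₂ (sym (H≡ τ))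
    ... | isRes r with ih (Resolution.edge r _) (falsifies-premise r τ fals)
    ...   | a , fa , c = a , fa , compatible-step r τ c

  -- Width of the clauses on the boundary.

  CellsOnly : Node → Set
  CellsOnly k = ∀ l → C k l ≡ true → IsCell (proj₁ l)

  module Boundary {k} (k→root : Path k root) (cells : CellsOnly k) (s : Bool) (κ : Fin n)
                  (r : Resolution (justif k)) (x≡ : Resolution.x r ≡ own s κ) where
    open Resolution r

    p : Node
    p = prem true

    own∉ : ∀ {i b} → C k (own s i , b) ≢ true
    own∉ e = ¬isCell-own s (cells _ e)

    own∈p : ∀ {i b} → C p (own s i , b) ≡ true → i ≡ κ × b ≡ true
    own∈p e with kept true _ e
    ... | inj₁ eq = own-injective s (trans (cong proj₁ eq) x≡) , cong proj₂ eq
    ... | inj₂ e′ = ⊥-elim (own∉ e′)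

    -- Regularity enters only here: the literal on own s κ of a big clause above p
    -- would have to be resolved both above p and at k.
    no-big : ∀ {j} → AxiomNode j (big s) → ¬ Path j p
    no-big {j} (C≡ , leaf) path with trace path (own s κ , false) (trans (C≡ _) (own∈big s κ))
    ... | inj₁ e with () ← proj₂ (own∈p e)
    ... | inj₂ (q , j→q , pivot-q , q→p) =
      regular (own s κ) (inAB-own s κ) j q k leaf j→q pivot-q
        (snoc⁺ q→p (edge true)) (trans pivot≡ (cong just x≡)) k→root

    -- If the literal does not survive to `p`, it is resolved on the way. The negative premise of
    -- that step would have a big axiom of side `s` as its source, which `no-big` excludes above
    -- `p`.
    own-above : ∀ {m i} → Path m p → C m (own s i , true) ≡ true → i ≡ κ
    own-above path e with trace path _ e
    ... | inj₁ e′ = proj₁ (own∈p e′)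
    ... | inj₂ (q , _ , pivot-q , q→p) with pivot-resolution pivot-q
    ...   | r′ , refl with source _ _ (Resolution.x∈prem r′ false)
    ...     | j , a , path′ , node , l∈ with refl ← own-only-in-big s a l∈
            = ⊥-elim (no-big node (path′ ◅◅ (Resolution.edge r′ false ◅ q→p)))

    -- One premise has the pivot with polarity `s`, so its source is the axiom `small s i j`. That
    -- axiom also contains `own s i`, and `own-above` applies.
    cell-pivot-above : ∀ {q i j} → Path q p → (r′ : Resolution (justif q)) → Resolution.x r′ ≡ cell s i j → i ≡ κ
    cell-pivot-above {i = i} {j} path r′ refl with source _ _ (Resolution.x∈prem r′ s)
    ... | m , a , path′ , (C≡ , leaf) , l∈ with refl ← cell-only-in-small s a l∈
        = own-above (path′ ◅◅ (Resolution.edge r′ s ◅ path)) (trans (C≡ _) (own∈small s i j))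

    -- A strategy inspects an assignment only at pivots left of z, and above `p` these are cells of
    -- row κ. Pivots right of z combine the premises' values pointwise.
    H-local : ∀ {α β} → (∀ j → α (cell s κ j) ≡ β (cell s κ j)) → ∀ m → Path m p → H m α ≡ H m β
    H-local {α} {β} α≡β = node-induction (λ m → Path m p → H m α ≡ H m β) step
      where
      step : ∀ m → (∀ {i} → Edge i m → Path i p → H i α ≡ H i β) → Path m p → H m α ≡ H m β
      step m ih path with view (justif m)
      ... | isAxiom _ _ H≡ _ _ = trans (H≡ α) (sym (H≡ β))
      ... | isRes r′ = by-level (lev-cases x′ (Resolution.x-exist r′))
        where
        open Resolution r′ using () renaming (x to x′; prem to prem′; edge to edge′; H-merge to H-merge′; H-join to H-join′)
        ih′ : ∀ b → H (prem′ b) α ≡ H (prem′ b) β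
        ih′ b = ih (edge′ b) (edge′ b ◅ path)
        α≡β-at-pivot : ∀ {y} → x′ ≡ y → SideView s y → levCR y ℕ.< 1 → α y ≡ β y
        α≡β-at-pivot eq (cellV i j) _ with refl ← cell-pivot-above path r′ eq = α≡β j
        α≡β-at-pivot eq zV (s≤s ())
        α≡β-at-pivot eq (ownV i) lt = ⊥-elim (<-asym lt (lev-own s))
        α≡β-at-pivot eq (otherV i) lt = ⊥-elim (<-asym lt (lev-own (not s)))
        by-level : levCR x′ ℕ.< 1 ⊎ 1 ℕ.< levCR x′ → H m α ≡ H m β
        by-level (inj₁ x<z) = begin
          H m α                    ≡⟨ H-merge′ x<z α ⟩
          H (prem′ (not (α x′))) α ≡⟨ ih′ _ ⟩
          H (prem′ (not (α x′))) β ≡⟨ cong (λ t → H (prem′ (not t)) β) (α≡β-at-pivot refl (sideView s x′) x<z) ⟩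
          H (prem′ (not (β x′))) β ≡⟨ sym (H-merge′ x<z β) ⟩
          H m β                    ∎
          where open ≡-Reasoning
        by-level (inj₂ z<x) = trans (proj₂ (H-join′ z<x α))
          (trans (cong₂ _∘v_ (ih′ true) (ih′ false)) (sym (proj₂ (H-join′ z<x β))))

    module _ {α₀} (falsified : Falsifies α₀ (C k)) {i j : Fin n} (i≢κ : i ≢ κ)
             (row-free : ∀ j′ b → C k (cell s i j′ , b) ≢ true)
             (column-free : ∀ i′ → C k (cell s i′ j , not s) ≢ true) where

      -- Changes α₀ only where `C k` stays falsified. For `t = s`, row i satisfies every own-side
      -- axiom `small s i _`; for `t = not s`, column j satisfies every opposite axiom
      -- `small (not s) j _`.
      fill : Bool → Fin n → Fin n → Bool
      fill t i′ j′ with i′ ≟ i | j′ ≟ j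
      ... | yes _ | _     = t
      ... | no _  | yes _ = not s
      ... | no _  | no _  = α₀ (cell s i′ j′)

      fill-row : ∀ t j′ → fill t i j′ ≡ t
      fill-row t j′ with i ≟ i
      ... | yes _  = refl
      ... | no i≢i = ⊥-elim (i≢i refl)

      fill-column : ∀ i′ → fill (not s) i′ j ≡ not s
      fill-column i′ with i′ ≟ i | j ≟ j
      ... | yes _ | _      = refl
      ... | no _  | yes _  = refl
      ... | no _  | no j≢j = ⊥-elim (j≢j refl)

      fill-κ : ∀ t u j′ → fill t κ j′ ≡ fill u κ j′
      fill-κ t u j′ with κ ≟ i | j′ ≟ j
      ... | yes κ≡i | _     = ⊥-elim (i≢κ (sym κ≡i))
      ... | no _    | yes _ = refl
      ... | no _    | no _  = refl

      fill-falsifies : ∀ t i′ j′ b → C k (cell s i′ j′ , b) ≡ true → fill t i′ j′ ≡ not b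
      fill-falsifies t i′ j′ b e with i′ ≟ i | j′ ≟ j
      ... | yes refl | _        = ⊥-elim (row-free j′ b e)
      -- By `column-free` a literal of `C k` in this column has polarity `s`, so the value `not s`
      -- falsifies it.
      ... | no _     | yes refl = Bool.¬-not λ { refl → column-free i′ e }
      ... | no _     | no _     = falsified _ b e

      -- Chosen so that only small axioms of one side can be falsified: those of side `not s` under
      -- α, those of side `s` under β. In each, one side is all false and the other false at a
      -- single index, which satisfies both big axioms; the small axioms at that index are satisfied
      -- by `fill`. Under β the own variables are the false ones, so the pivot literal in `p` is
      -- falsified as well.
      α β : Var → Bool
      α = assignment s (fill s) (λ i′ → not (i′ ==ᶠ i)) (λ _ → false)
      β = assignment s (fill (not s)) (λ _ → false) (λ j′ → not (j′ ==ᶠ j))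

      α-falsifies : Falsifies α (C k)
      α-falsifies v b e with sideView s v
      ... | cellV i′ j′ = trans (assignment-cell _ _ _ s i′ j′) (fill-falsifies s i′ j′ b e)
      ... | zV          = ⊥-elim (cells _ e)
      ... | ownV _      = ⊥-elim (own∉ e)
      ... | otherV _    = ⊥-elim (¬isCell-own (not s) (cells _ e))

      β-falsifies : Falsifies β (C p)
      β-falsifies v b e with kept true (v , b) e
      ... | inj₁ refl = trans (cong β x≡) (assignment-own _ _ _ s κ)
      ... | inj₂ e′ with sideView s v
      ...   | cellV i′ j′ = trans (assignment-cell _ _ _ s i′ j′) (fill-falsifies (not s) i′ j′ b e′)
      ...   | zV          = ⊥-elim (cells _ e′)
      ...   | ownV _      = ⊥-elim (own∉ e′)
      ...   | otherV _    = ⊥-elim (¬isCell-own (not s) (cells _ e′))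

      α-axiom : ∀ a → Falsifies α (∃clause a) → axiomVal a ≡ sideVal (not s)
      α-axiom (small t i′ j′) fals with side-cases t s
      ... | inj₂ refl = refl
      ... | inj₁ refl with not-==ᶠ i′ i (trans (sym (assignment-own _ _ _ s i′)) (fals _ _ (own∈small s i′ j′)))
      ...   | refl = ⊥-elim (Bool.not-¬ refl (begin
                       s               ≡⟨ sym (fill-row s j′) ⟩
                       fill s i j′     ≡⟨ sym (assignment-cell _ _ _ s i j′) ⟩
                       α (cell s i j′) ≡⟨ fals _ _ (cell∈small s i j′) ⟩
                       not s           ∎))
        where open ≡-Reasoning
      α-axiom (big t) fals with side-cases t s
      ... | inj₁ refl = ⊥-elim (true≢false (trans (sym (fals _ _ (own∈big s i)))
                                 (trans (assignment-own _ _ _ s i) (cong not (==ᶠ-refl i)))))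
      ... | inj₂ refl = ⊥-elim (true≢false (trans (sym (fals _ _ (own∈big (not s) i)))
                                 (assignment-other _ _ _ s i)))

      β-axiom : ∀ a → Falsifies β (∃clause a) → axiomVal a ≡ sideVal s
      β-axiom (small t j′ i′) fals with side-cases t s
      ... | inj₁ refl = refl
      ... | inj₂ refl with not-==ᶠ j′ j (trans (sym (assignment-other _ _ _ s j′)) (fals _ _ (own∈small (not s) j′ i′)))
      ...   | refl = ⊥-elim (Bool.not-¬ refl (begin
                       not s                 ≡⟨ sym (fill-column i′) ⟩
                       fill (not s) i′ j     ≡⟨ sym (assignment-cell′ _ _ _ s j i′) ⟩
                       β (cell (not s) j i′) ≡⟨ fals _ _ (cell∈small (not s) j i′) ⟩
                       not (not s)           ∎))
        where open ≡-Reasoning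
      β-axiom (big t) fals with side-cases t s
      ... | inj₁ refl = ⊥-elim (true≢false (trans (sym (fals _ _ (own∈big s κ)))
                                 (assignment-own _ _ _ s κ)))
      ... | inj₂ refl = ⊥-elim (true≢false (trans (sym (fals _ _ (own∈big (not s) j)))
                                 (trans (assignment-other _ _ _ s j) (cong not (==ᶠ-refl j)))))

      Hα≡Hβ : H p α ≡ H p β
      Hα≡Hβ = H-local {α} {β} (λ j′ → trans (assignment-cell _ _ _ s κ j′)
                (trans (fill-κ s (not s) j′) (sym (assignment-cell _ _ _ s κ j′)))) p ε

      -- The pivot lies right of z and `p` is the left operand of the composition, so its value
      -- survives unless it is ⋆.
      k-vs-p : Compatible (H p α) (H k α)
      k-vs-p = subst (Compatible (H p α)) (sym (proj₂ (H-join (subst (λ v → 1 ℕ.< levCR v) (sym x≡) (lev-own s)) α))) ∘v-⋆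

      impossible : ⊥
      impossible with sound α k α-falsifies | sound β p β-falsifies
      -- The response at `p` is `sideVal s` under β, hence also under α. Not being ⋆, it would have
      -- to equal the response `sideVal (not s)` at `k`.
      ... | a , fa , ca | b , fb , cb = clash s (Hk ca) (Hp cb)
        where
        compatible-sideVal : ∀ t {v w} → v ≡ sideVal t → Compatible v w → w ≡ sideVal t
        compatible-sideVal true  refl (inj₂ e) = sym e
        compatible-sideVal false refl (inj₂ e) = sym e
        Hk : Compatible (axiomVal a) (H k α) → H k α ≡ sideVal (not s)
        Hk = compatible-sideVal (not s) (α-axiom a fa)
        Hp : Compatible (axiomVal b) (H p β) → H p β ≡ sideVal s
        Hp = compatible-sideVal s (β-axiom b fb)
        clash : ∀ t → H k α ≡ sideVal (not t) → H p β ≡ sideVal t → ⊥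
        clash t ek ep with subst₂ Compatible (trans Hα≡Hβ ep) ek k-vs-p
        clash true  _ _ | inj₁ ()
        clash true  _ _ | inj₂ ()
        clash false _ _ | inj₁ ()
        clash false _ _ | inj₂ ()

    mentioned : Var → Set
    mentioned v = ∃ λ b → C k (v , b) ≡ true

    mentioned? : ∀ v → Dec (mentioned v)
    mentioned? v with C k (v , true) in e₁ | C k (v , false) in e₀
    ... | true  | _     = yes (true , e₁)
    ... | false | true  = yes (false , e₀)
    ... | false | false = no λ { (true , e) → true≢false (trans (sym e) e₁) ; (false , e) → true≢false (trans (sym e) e₀) }

    -- By `impossible`, an unmentioned row other than κ cannot coexist with an unmentioned column.
    wide : ∀ {α₀} → Falsifies α₀ (C k) →
           (∀ i → i ≢ κ → ∃ λ j → mentioned (cell s i j)) ⊎ (∀ j → ∃ λ i → mentioned (cell s i j))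
    wide falsified with all? (λ i → (i ≟ κ) ⊎-dec any? (λ j → mentioned? (cell s i j)))
    ... | yes rows = inj₁ λ i i≢κ → fromInj₂ (⊥-elim ∘ i≢κ) (rows i)
    ... | no ¬rows with ¬∀⟶∃¬ n _ (λ i → (i ≟ κ) ⊎-dec any? (λ j → mentioned? (cell s i j))) ¬rows
    ...   | i , ¬row = inj₂ column
      where
      column : ∀ j → ∃ λ i′ → mentioned (cell s i′ j)
      column j with any? (λ i′ → mentioned? (cell s i′ j))
      ... | yes m = m
      ... | no ¬m = ⊥-elim (impossible falsified (¬row ∘ inj₁)
                      (λ j′ b e → ¬row (inj₂ (j′ , b , e))) (λ i′ e → ¬m (i′ , _ , e)))

  -- Descent from the root to the boundary.

  record OnBoundary (k : Node) : Set where
    field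
      k→root : Path k root
      cells  : CellsOnly k
      s      : Bool
      κ      : Fin n
      r      : Resolution (justif k)
      x≡     : Resolution.x r ≡ own s κ

  module _ (i₀ : Fin n) (τ : Var → Bool) where

    Descends : Node → Set
    Descends k = Path k root → CellsOnly k → Falsifies τ (C k) → ∃ λ k′ → OnBoundary k′ × Falsifies τ (C k′)

    -- While the pivot is a cell, the falsified premise again has only cells. The walk cannot reach
    -- an axiom, since each contains an a- or b-literal, so it meets an a- or b-pivot.
    descend : ∀ k → Descends k
    descend = node-induction Descends step
      where
      step : ∀ k → (∀ {i} → Edge i k → Descends i) → Descends k
      step k ih k→root cells fals with view (justif k)
      ... | isAxiom (small s i j) C≡ _ _ _ = ⊥-elim (¬isCell-own s (cells _ (trans (C≡ _) (own∈small s i j))))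
      -- The index `i₀` guarantees that the big clause is nonempty.
      ... | isAxiom (big s) C≡ _ _ _       = ⊥-elim (¬isCell-own s (cells _ (trans (C≡ _) (own∈big s i₀))))
      ... | isRes r = by-pivot (sideView true x) refl
        where
        open Resolution r
        b = not (τ x)
        boundary : ∀ s κ → x ≡ own s κ → ∃ λ k′ → OnBoundary k′ × Falsifies τ (C k′)
        boundary s κ x≡ = k , record { k→root = k→root ; cells = cells ; s = s ; κ = κ ; r = r ; x≡ = x≡ } , fals
        by-pivot : ∀ {y} → SideView true y → x ≡ y → ∃ λ k′ → OnBoundary k′ × Falsifies τ (C k′)
        by-pivot (ownV κ)   x≡ = boundary true κ x≡
        by-pivot (otherV κ) x≡ = boundary false κ x≡
        by-pivot zV         x≡ with () ← trans (cong univCR (sym x≡)) x-exist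
        by-pivot (cellV i j) x≡ =
          ih (edge b) (edge b ◅ k→root) premise-cells (falsifies-premise r τ fals)
          where
          premise-cells : CellsOnly (prem b)
          premise-cells l l∈ with kept b l l∈
          ... | inj₁ refl = subst IsCell (sym x≡) _
          ... | inj₂ l∈k  = cells l l∈k

    boundary-line : ∃ λ k → OnBoundary k × Falsifies τ (C k)
    boundary-line = descend root ε
      (λ l l∈ → ⊥-elim (true≢false (trans (sym l∈) (empty l))))
      (λ v b v∈ → ⊥-elim (true≢false (trans (sym v∈) (empty (v , b)))))

-- From boundary clauses to the size bound.

gridAssignment : ∀ {n} → Grid n → CRVar n → Bool
gridAssignment m (xv i j) = entry m i j
gridAssignment m _        = false

-- If both polarities of a cell occur, no grid falsifies the clause, so preferring `just false` does
-- no harm.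
falsifier : ∀ {n} → Clause (CRVar n) → PartialGrid n
falsifier D i j = if D (xv i j , true) then just false else if D (xv i j , false) then just true else nothing

falsifier-agrees : ∀ {n} (D : Clause (CRVar n)) m → Falsifies (gridAssignment m) D →
                   ∀ i j → Agrees (falsifier D i j) (entry m i j)
falsifier-agrees D m fals i j b eq with D (xv i j , true) in e₁ | D (xv i j , false) in e₀
falsifier-agrees D m fals i j _ refl | true  | _    = fals (xv i j) true e₁
falsifier-agrees D m fals i j _ refl | false | true = fals (xv i j) false e₀

falsifier-defined : ∀ {n} (D : Clause (CRVar n)) i j → (∃ λ b → D (xv i j , b) ≡ true) → 1 ≤ ∣ falsifier D i j ∣
falsifier-defined D i j (b , e) with D (xv i j , true) in e₁ | D (xv i j , false) in e₀
... | true  | _     = s≤s z≤n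
... | false | true  = s≤s z≤n
... | false | false with b
...   | true  = ⊥-elim (true≢false (trans (sym e) e₁))
...   | false = ⊥-elim (true≢false (trans (sym e) e₀))

double-sum-≥ : ∀ {n} κ (g : Fin (suc n) → Fin (suc n) → ℕ) →
  (∀ i → i ≢ κ → ∃ λ j → 1 ≤ g i j) ⊎ (∀ j → ∃ λ i → 1 ≤ g i j) →
  n ≤ sum (λ i → sum (g i))
double-sum-≥ κ g (inj₁ rows) = sum-≥-all-but-one _ κ λ i i≢κ →
  ≤-trans (proj₂ (rows i i≢κ)) (term≤sum (g i) _)
-- Every column contributes here; column κ is dropped only to reuse the bound for rows.
double-sum-≥ {n} κ g (inj₂ columns) = subst (n ≤_) (sym (∑-comm g))
  (sum-≥-all-but-one (λ j → sum (λ i → g i j)) κ λ j _ → ≤-trans (proj₂ (columns j)) (term≤sum (λ i → g i j) _))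

falsifier-wide : ∀ {n} (D : Clause (CRVar (suc n))) s κ →
  (∀ i → i ≢ κ → ∃ λ j → ∃ λ b → D (cell s i j , b) ≡ true) ⊎ (∀ j → ∃ λ i → ∃ λ b → D (cell s i j , b) ≡ true) →
  n ≤ width (falsifier D)
falsifier-wide D true κ c = double-sum-≥ κ _
  (Sum.map (λ rows i i≢κ → map₂ (falsifier-defined D i _) (rows i i≢κ))
           (λ columns j → map₂ (falsifier-defined D _ j) (columns j)) c)
falsifier-wide {n} D false κ c = subst (n ≤_) (sym (∑-comm (λ i j → ∣ falsifier D i j ∣)))
  (double-sum-≥ κ (λ i j → ∣ falsifier D j i ∣)
    (Sum.map (λ rows i i≢κ → map₂ (falsifier-defined D _ i) (rows i i≢κ))
             (λ columns j → map₂ (falsifier-defined D j _) (columns j)) c))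

module _ {R n} (π : MRes.Refutation (CR (suc n)) R) (regular : MRes.Regular (CR (suc n)) R InAB π) where
  open Refuted {R} π regular

  -- Each grid is sent to a boundary line whose clause it falsifies. Of the n + 1 rows one may be
  -- lost to κ, which leaves width n for the union bound.
  size-bound : 2 ^ n ≤ MRes.size (CR (suc n)) R π
  size-bound = cover-bound n (proj₁ ∘ line) (falsifier ∘ C)
    (λ m → falsifier-agrees _ m (proj₂ (proj₂ (line m))))
    (λ m → wide-line (proj₁ (proj₂ (line m))) (proj₂ (proj₂ (line m))))
    where
    line : ∀ m → ∃ λ k → OnBoundary k × Falsifies (gridAssignment m) (C k)
    line m = boundary-line zero (gridAssignment m)
    wide-line : ∀ {k τ} → OnBoundary k → Falsifies τ (C k) → n ≤ width (falsifier (C k))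
    wide-line {k} B fals = falsifier-wide (C k) s κ (Boundary.wide k→root cells s κ r x≡ fals)
      where open OnBoundary B

theorem12 : (R : Representation) → Complete R →
    Σ ℕ λ d → Σ ℕ λ n₀ → ∀ n → n₀ ≤ n →
    (π : MRes.Refutation (CR n) R) →
    MRes.Regular (CR n) R InAB π →
    2 ^ n ≤ MRes.size (CR n) R π ^ d
-- The size is at least `2 ^ (n - 1)`, and squaring it reaches `2 ^ n` as soon as `2 * (n - 1)` is
-- at least `n`, that is from `n = 2` on.
theorem12 R _ = 2 , 2 , bound
  where
  bound : ∀ n → 2 ≤ n → (π : MRes.Refutation (CR n) R) → MRes.Regular (CR n) R InAB π →
          2 ^ n ≤ MRes.size (CR n) R π ^ 2
  bound (suc zero) (s≤s ())
  bound (suc (suc n)) _ π regular = begin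
    2 ^ suc (suc n)                           ≡⟨ *-comm 2 (2 ^ suc n) ⟩
    2 ^ suc n * 2                             ≤⟨ *-monoʳ-≤ (2 ^ suc n) (^-monoʳ-≤ 2 {1} {suc n} (s≤s z≤n)) ⟩
    2 ^ suc n * 2 ^ suc n                     ≤⟨ *-mono-≤ (size-bound {R} π regular) (size-bound {R} π regular) ⟩
    M * M                                     ≡⟨ cong (M *_) (sym (*-identityʳ M)) ⟩
    M ^ 2                                     ∎
    where
    open ≤-Reasoning
    M = MRes.size (CR (suc (suc n))) R π
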